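{- The universe $\hat{\mathcal{U}}_0^{\mathrm{pr}}$ is closed under $\Sigma$-types: if $(A,r,s,p):\hat{\mathcal{U}}_0^{\mathrm{pr}}$ and for each $a:A$ we have $(B(a),r_a,s_a,p_a):\hat{\mathcal{U}}_0^{\mathrm{pr}}$, then $(a:A)\times B(a)$ underlies an element of $\hat{\mathcal{U}}_0^{\mathrm{pr}}$.
   Context: $\mathcal R=\mathrm{Sh}(\mathrm{R},\mathrm{J}_{\mathrm{fin}})$, where $\mathrm{R}$ has objects $\mathbf 1$ (terminal) and $\mathbf N$, $\mathrm{R}(\mathbf N,\mathbf N)$ = primitive recursive functions $\mathbb N\to\mathbb N$, $\mathrm{R}(\mathbf 1,\mathbf N)=\mathbb N$, and $\mathrm{J}_{\mathrm{fin}}$ is generated by finite jointly surjective families. A primitive recursive bijection $\mathbb N\to\mathbb N\times\mathbb N$ with primitive recursive inverse is fixed (so $\mathbf y_{\mathbf N}\times\mathbf y_{\mathbf N}\cong\mathbf y_{\mathbf N}$). With a strong universe $\mathcal U_0$ in $\mathcal R$, $\hat{\mathcal U}_0^{\mathrm{pr}}:=(X:\mathcal U_0)\times(r:\mathbf y_{\mathbf N}\to X+1)\times(s:X+1\to\mathbf y_{\mathbf N})\times(r\circ s=\mathrm{id}_{X+1})$ (internal language of $\mathcal R$). -}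

module Defs where

open import Data.Sum using (_⊎_)
open import Data.Unit using (⊤)
open import Data.Product using (Σ)
open import Relation.Binary.PropositionalEquality using (_≡_)

-- Internal-language reading: types of R are Agda types, the strong universe
-- U₀ is Set, and yN is an abstract type N (equipped, in the theorem, with
-- the fixed pairing isomorphism N ≅ N × N).

-- The structure (r : N → X + 1) × (s : X + 1 → N) × (r ∘ s = id).
-- r ∘ s = id is stated pointwise (equivalent under function extensionality,
-- which holds in the topos).
record PrRetract (N : Set) (X : Set) : Set where
  field
    r : N → X ⊎ ⊤
    s : X ⊎ ⊤ → N
    p : (x : X ⊎ ⊤) → r (s x) ≡ x

Upr : Set → Set₁
Upr N = Σ Set (PrRetract N)

{-# OPTIONS --safe #-}

-- An element of Û₀^pr is a type X together with a retraction of N onto X + 1.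
-- Retractions compose, and N ≅ N × N, so it suffices to retract N × N onto
-- (Σ A B) + 1: decode the first coordinate to a : A + 1 and the second to an
-- element of B a + 1 (or of 1 if a is the added point), then collapse every
-- added point to the one of (Σ A B) + 1.
module Submission where

open import Defs
open import Data.Product using (Σ; _×_; _,_)
open import Data.Product.Function.Dependent.Propositional using (Σ-↩)
open import Data.Sum using (_⊎_; inj₁; inj₂)
open import Data.Unit using (⊤; tt)
open import Function.Bundles using (_↔_; _↩_; mk↩; module LeftInverse)
open import Function.Construct.Composition using (_↩-∘_)
open import Function.Properties.Inverse using (↔⇒↩)
open import Relation.Binary.PropositionalEquality using (_≡_; refl)

module _ {N X : Set} where

  PrRetract⇒↩ : PrRetract N X → N ↩ (X ⊎ ⊤)
  PrRetract⇒↩ R = mk↩ {to = r} {from = s} λ { refl → p _ }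
    where open PrRetract R

  ↩⇒PrRetract : N ↩ (X ⊎ ⊤) → PrRetract N X
  ↩⇒PrRetract N↩X⊤ = record { r = to ; s = from ; p = strictlyInverseˡ }
    where open LeftInverse N↩X⊤

↩-⊤ : {N : Set} → N → N ↩ ⊤
↩-⊤ n = mk↩ {from = λ _ → n} λ _ → refl

module _ {A : Set} (B : A → Set) where

  Optional : A ⊎ ⊤ → Set
  Optional (inj₁ a) = B a ⊎ ⊤
  Optional (inj₂ _) = ⊤

  collapse : Σ (A ⊎ ⊤) Optional → Σ A B ⊎ ⊤
  collapse (inj₁ a , inj₁ b) = inj₁ (a , b)
  collapse (inj₁ a , inj₂ _) = inj₂ tt
  collapse (inj₂ _ , _)      = inj₂ tt

  uncollapse : Σ A B ⊎ ⊤ → Σ (A ⊎ ⊤) Optional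
  uncollapse (inj₁ (a , b)) = inj₁ a , inj₁ b
  uncollapse (inj₂ _)       = inj₂ tt , tt

  collapse∘uncollapse : (x : Σ A B ⊎ ⊤) → collapse (uncollapse x) ≡ x
  collapse∘uncollapse (inj₁ _) = refl
  collapse∘uncollapse (inj₂ _) = refl

  Σ-Optional-↩ : Σ (A ⊎ ⊤) Optional ↩ (Σ A B ⊎ ⊤)
  Σ-Optional-↩ =
    mk↩ {to = collapse} {from = uncollapse} λ { refl → collapse∘uncollapse _ }

  Optional-↩ : {N : Set} → N → ((a : A) → N ↩ (B a ⊎ ⊤)) →
               (x : A ⊎ ⊤) → N ↩ Optional x
  Optional-↩ n N↩B (inj₁ a) = N↩B a
  Optional-↩ n N↩B (inj₂ _) = ↩-⊤ n

mainTheorem17 : (N : Set) → N ↔ (N × N) →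
    (A : Set) → PrRetract N A →
    (B : A → Set) → ((a : A) → PrRetract N (B a)) →
    PrRetract N (Σ A B)
mainTheorem17 N N↔N×N A RA B RB =
  ↩⇒PrRetract (Σ-Optional-↩ B ↩-∘ (N×N↩ΣOptional ↩-∘ ↔⇒↩ N↔N×N))
  where
    N↩A⊤ : N ↩ (A ⊎ ⊤)
    N↩A⊤ = PrRetract⇒↩ RA

    N×N↩ΣOptional : (N × N) ↩ Σ (A ⊎ ⊤) (Optional B)
    N×N↩ΣOptional =
      Σ-↩ N↩A⊤ λ {m} → Optional-↩ B (PrRetract.s RA (inj₂ tt))
                         (λ a → PrRetract⇒↩ (RB a)) (LeftInverse.to N↩A⊤ m)
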